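{- Let $n\ge1$ and let $D=d/dx$. The generating polynomial of rooted trees on $n$ labelled vertices enriched with partitions whose blocks are linearly ordered, each block weighted with $x$, is the sum of the numerators in the expansion of $(xD)^{n-1}(1-x)^{ -n}$ in simple fractions; that is, if $$(xD)^{n-1}\frac{1}{(1-x)^n}=\sum_{k=0}^{n-1}\frac{a_{n,k}\,x^k}{(1-x)^{n+k}}$$ with constants $a_{n,k}$ (which exist and are uniquely determined), then this generating polynomial equals $\sum_{k=0}^{n-1}a_{n,k}x^k$.
   Context: The enriched trees in question are (non-plane) rooted trees $T$ on the vertex set $\{1,\dots,n\}$ together with, for each vertex $v$, an ordered set partition (a linearly ordered sequence of nonempty, pairwise disjoint blocks with union equal) of the set $T^{ -1}(v)$ of children of $v$ (the empty sequence if $v$ has no children). The weight of such an object is $x$ raised to the total number of blocks, and the generating polynomial is the sum of the weights of all such objects. -}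

module Defs where

open import Level using (0ℓ)
open import Algebra.Bundles.Raw using (RawRing; RawSemiring)
import Algebra.Definitions.RawSemiring as SemiringOps
open import Data.Nat.Base as ℕ using (ℕ; zero; suc; pred)
open import Data.Nat.GeneralisedArithmetic using (fold)
open import Data.Integer.Base using (+_)
open import Data.Rational.Base as ℚ using (ℚ; 0ℚ; 1ℚ)
import Data.Rational.Properties as ℚₚ
open import Data.Fin.Base as Fin using (Fin; toℕ)
open import Data.Fin.Subset using (Subset; _∈_; _∩_; ⋃; Nonempty; Empty)
open import Data.List.Base using (List; length)
open import Data.List.Relation.Unary.All using (All)
open import Data.List.Relation.Unary.AllPairs using (AllPairs)
open import Data.Maybe.Base using (Maybe; just; nothing)
open import Data.Product.Base using (_×_; _,_; ∃-syntax; Σ-syntax)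
open import Function.Bundles using (Inverse; _⇔_)
open import Relation.Binary.Bundles using (Setoid)
open import Relation.Binary.Construct.Closure.ReflexiveTransitive using (Star)
open import Relation.Binary.PropositionalEquality
  using (_≡_; refl; sym; trans; cong; cong₂; _≗_; setoid)

------------------------------------------------------------------------
-- Formal power series over ℚ

-- f m is the coefficient of x^m.  Polynomials are the series with finitely
-- many nonzero coefficients; rational functions without a pole at 0 are
-- identified with their expansions.
Series : Set
Series = ℕ → ℚ

constant : ℚ → Series
constant c zero    = c
constant c (suc _) = 0ℚ

X : Series
X zero          = 0ℚ
X (suc zero)    = 1ℚ
X (suc (suc _)) = 0ℚ

seriesRing : RawRing 0ℓ 0ℓ
seriesRing = record
  { Carrier = Series
  ; _≈_     = _≗_
  ; _+_     = λ f g m → f m ℚ.+ g m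
  ; _*_     = λ f g m → ∑ {suc m} (λ i → f (toℕ i) ℚ.* g (m ℕ.∸ toℕ i))
  ; -_      = λ f m → ℚ.- f m
  ; 0#      = constant 0ℚ
  ; 1#      = constant 1ℚ
  }
  where open SemiringOps ℚ.+-*-rawSemiring using () renaming (sum to ∑)

open RawRing seriesRing public using (_≈_; _+_; _*_; -_; 0#; 1#)
open SemiringOps (RawRing.rawSemiring seriesRing) public using (sum; _^_)

D : Series → Series
D f m = (+ suc m ℚ./ 1) ℚ.* f (suc m)

xD : Series → Series
xD f = X * D f

[1-X]⁻¹ : Series
[1-X]⁻¹ _ = 1ℚ

[1-X]⁻¹-inverse : (1# + - X) * [1-X]⁻¹ ≈ 1#
[1-X]⁻¹-inverse zero    = refl
[1-X]⁻¹-inverse (suc m) = cong (λ s → 1ℚ ℚ.+ (ℚ.- 1ℚ ℚ.+ s)) (zeros m)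
  where
  open SemiringOps ℚ.+-*-rawSemiring using () renaming (sum to ∑)

  zeros : ∀ k → ∑ {k} (λ _ → 0ℚ ℚ.* 1ℚ) ≡ 0ℚ
  zeros zero    = refl
  zeros (suc k) = trans (ℚₚ.+-identityˡ _) (zeros k)

polynomial : ∀ {n} → (Fin n → ℚ) → Series
polynomial a = sum (λ k → constant (a k) * X ^ toℕ k)

-- The coefficients a satisfy
--   (xD)^(n-1) (1-x)^(-n) = ∑_{k<n} a_k x^k / (1-x)^(n+k).
IsSimpleFractionExpansion : (n : ℕ) → (Fin n → ℚ) → Set
IsSimpleFractionExpansion n a =
  fold ([1-X]⁻¹ ^ n) xD (pred n)
    ≈ sum (λ k → constant (a k) * X ^ toℕ k * [1-X]⁻¹ ^ (n ℕ.+ toℕ k))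

------------------------------------------------------------------------
-- Enriched rooted trees on the vertex set Fin n

-- A rooted tree is given by its parent function.  Since the root has no
-- parent and every vertex has the root as an ancestor, the root is the only
-- vertex without a parent and there are no cycles.
record RootedTree (n : ℕ) : Set where
  field
    root        : Fin n
    parent      : Fin n → Maybe (Fin n)
    root-orphan : parent root ≡ nothing
    connected   : ∀ v → Star (λ u w → parent u ≡ just w) v root

record IsOrderedPartition {n} (C : Fin n → Set) (bs : List (Subset n)) : Set where
  field
    nonempty : All Nonempty bs
    disjoint : AllPairs (λ p q → Empty (p ∩ q)) bs
    covers   : ∀ u → u ∈ ⋃ bs ⇔ C u

record EnrichedTree (n : ℕ) : Set where
  field
    tree : RootedTree n

  open RootedTree tree public

  IsChildOf : Fin n → Fin n → Set
  IsChildOf v u = parent u ≡ just v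

  field
    blocks      : Fin n → List (Subset n)
    isPartition : ∀ v → IsOrderedPartition (IsChildOf v) (blocks v)

  blockCount : ℕ
  blockCount = ∑ (λ v → length (blocks v))
    where open SemiringOps ℕ.+-*-rawSemiring using () renaming (sum to ∑)

-- Two enriched trees are the same when they agree as data, irrespective of
-- the proofs they carry.
enrichedTrees : ℕ → Setoid 0ℓ 0ℓ
enrichedTrees n = record
  { Carrier       = EnrichedTree n
  ; _≈_           = λ S T → root S ≡ root T × parent S ≗ parent T × blocks S ≗ blocks T
  ; isEquivalence = record
    { refl  = refl , (λ _ → refl) , (λ _ → refl)
    ; sym   = λ (p , q , r) → sym p , (λ v → sym (q v)) , (λ v → sym (r v))
    ; trans = λ (p , q , r) (p′ , q′ , r′) →
        trans p p′ , (λ v → trans (q v) (q′ v)) , (λ v → trans (r v) (r′ v))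
    }
  }
  where open EnrichedTree

-- P is the sum of x^(number of blocks) over the finite set of all enriched
-- trees on n vertices; the sum is taken along an enumeration without
-- repetition, and does not depend on which one is chosen.
IsGeneratingPolynomial : ℕ → Series → Set
IsGeneratingPolynomial n P =
  ∃[ N ] Σ[ e ∈ Inverse (setoid (Fin N)) (enrichedTrees n) ]
    P ≈ sum (λ i → X ^ EnrichedTree.blockCount (Inverse.to e i))

{-# OPTIONS --safe #-}

-- Put n = m + 1.  Coefficientwise, (xD)^m multiplies the coefficient of x^j by
-- j^m, and x D (x^k (1-x)^(-N)) = k x^k (1-x)^(-N) + N x^(k+1) (1-x)^(-N-1).
-- By induction on m the numerators are a_k = G(m,k) M(n,k), where G(m,k) is the
-- number of surjections from m onto k points and M(n,k) the number of weak
-- compositions of k into n parts.  They are unique because x^k (1-x)^(-n-k)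
-- starts with x^k.
--
-- On the side of trees, M(n,k) chooses how many blocks each vertex gets, and it
-- remains to see that, whatever the choice, there are G(m,k) trees with these k
-- blocks.  Some vertex l has no blocks, as k < n; it is a leaf lying in some
-- block s.  Deleting l leaves a tree on n - 1 vertices, with k blocks or, if l
-- was alone in s, with k - 1; this is the recurrence
-- G(m+1,k) = k (G(m,k) + G(m,k-1)).

module Submission where

open import Level using (0ℓ)
open import Algebra.Bundles using (Ring)
import Algebra.Properties.Group as GroupProperties
import Algebra.Properties.Semiring.Sum as SemiringSum
open import Data.Bool.Base using (true)
open import Data.Empty using (⊥)
open import Data.Fin.Base using (Fin; zero; suc; toℕ; fromℕ<; punchIn; punchOut; _↑ˡ_; _↑ʳ_)
import Data.Fin.Properties as Finₚ
open import Data.Fin.Subset using (Subset; _∈_; ⋃)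
import Data.Fin.Subset.Properties as Subsetₚ
open import Data.Integer.Base as ℤ using (+_)
import Data.Integer.Properties as ℤₚ
open import Data.List.Base using (List; []; _∷_; length)
import Data.List.Properties as Listₚ
open import Data.List.Relation.Unary.All using (All; []; _∷_)
open import Data.List.Relation.Unary.AllPairs using (AllPairs; []; _∷_)
open import Data.List.Relation.Unary.Any using (Any; here; there)
open import Data.Maybe.Base as Maybe using (Maybe; just; nothing)
import Data.Maybe.Properties as Maybeₚ
open import Data.Nat.Base as ℕ using (ℕ; zero; suc; _≤_; _<_; _≥_; z≤n; s≤s; s≤s⁻¹; z<s; s<s)
open import Data.Nat.GeneralisedArithmetic using (fold)
import Data.Nat.Properties as ℕₚ
open import Data.Nat.Tactic.RingSolver using (solve-∀)
open import Data.Product.Base using (Σ; _×_; _,_; proj₁; proj₂; ∃-syntax)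
open import Data.Product using (∃!)
open import Data.Product.Function.NonDependent.Propositional using (_×-↔_)
open import Data.Rational.Base as ℚ using (ℚ; 0ℚ; 1ℚ)
import Data.Rational.Properties as ℚₚ
import Data.Rational.Unnormalised.Base as ℚᵘ
import Data.Rational.Unnormalised.Properties as ℚᵘₚ
open import Data.Sum.Base using (_⊎_; inj₁; inj₂; [_,_]′)
open import Data.Sum.Function.Propositional using (_⊎-↔_)
open import Data.Unit.Base using (⊤; tt)
open import Data.Vec.Base using (tabulate)
import Data.Vec.Functional as Vector
open import Data.Vec.Functional.Properties using (insertAt-lookup; insertAt-punchIn)
open import Data.Vec.Properties using (lookup∘tabulate; tabulate-cong; []=⇒lookup; lookup⇒[]=)
open import Function.Base using (_∘_; id)
open import Function.Bundles using (Bijection; Inverse; Equivalence; _↔_; mk⇔; mk↔ₛ′)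
open import Function.Construct.Composition using (inverse)
open import Function.Construct.Identity using (↔-id)
open import Function.Definitions using (Injective; StrictlySurjective)
open import Function.Properties.Bijection using (Bijection⇒Inverse)
open import Function.Properties.Inverse using (↔-trans)
open import Relation.Binary.Bundles using (Setoid)
open import Relation.Binary.Construct.Closure.ReflexiveTransitive as Star using (Star; ε; _◅_)
open import Relation.Binary.Core using (Rel)
open import Relation.Binary.Definitions using (Symmetric)
open import Relation.Binary.PropositionalEquality
open import Relation.Nullary.Decidable using (Dec; does; yes; no; ¬?; decidable-stable)
open import Relation.Nullary.Negation using (¬_; contradiction)
open import Relation.Unary using (Pred)
open import Defs

module ℕΣ = SemiringSum ℕₚ.+-*-semiring
module ℚΣ = SemiringSum (Ring.semiring ℚₚ.+-*-ring)

-- The numerators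

multichoose : ℕ → ℕ → ℕ
multichoose n       zero    = 1
multichoose zero    (suc k) = 0
multichoose (suc n) (suc k) = multichoose n (suc k) ℕ.+ multichoose (suc n) k

surjections : ℕ → ℕ → ℕ
surjections zero    zero    = 1
surjections zero    (suc k) = 0
surjections (suc m) zero    = 0
surjections (suc m) (suc k) = suc k ℕ.* (surjections m (suc k) ℕ.+ surjections m k)

multichoose-absorb : ∀ n k → suc k ℕ.* multichoose n (suc k) ≡ (n ℕ.+ k) ℕ.* multichoose n k
multichoose-absorb zero    zero    = refl
multichoose-absorb zero    (suc k) = trans (ℕₚ.*-zeroʳ k) (sym (ℕₚ.*-zeroʳ k))
multichoose-absorb (suc n) zero    = 
  trans (lemma (multichoose n 1)) (trans (cong suc (multichoose-absorb n 0)) (lemma₂ n))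
  where
  lemma : ∀ x → 1 ℕ.* (x ℕ.+ 1) ≡ suc (1 ℕ.* x)
  lemma = solve-∀
  lemma₂ : ∀ n → suc ((n ℕ.+ 0) ℕ.* 1) ≡ suc (n ℕ.+ 0) ℕ.* 1
  lemma₂ = solve-∀
multichoose-absorb (suc n) (suc k) = begin
  suc (suc k) ℕ.* (a ℕ.+ b)                               ≡⟨ expand k a b ⟩
  suc (suc k) ℕ.* a ℕ.+ (b ℕ.+ suc k ℕ.* b)
    ≡⟨ cong₂ (λ x y → x ℕ.+ (b ℕ.+ y)) (multichoose-absorb n (suc k)) (multichoose-absorb (suc n) k) ⟩
  (n ℕ.+ suc k) ℕ.* c ℕ.+ (b ℕ.+ suc (n ℕ.+ k) ℕ.* d)    ≡⟨ collect n k c d ⟩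
  suc (n ℕ.+ suc k) ℕ.* b                                ∎
  where
  open ≡-Reasoning
  a = multichoose n (suc (suc k))
  b = multichoose (suc n) (suc k)
  c = multichoose n (suc k)
  d = multichoose (suc n) k
  expand : ∀ k a b → suc (suc k) ℕ.* (a ℕ.+ b) ≡ suc (suc k) ℕ.* a ℕ.+ (b ℕ.+ suc k ℕ.* b)
  expand = solve-∀
  collect : ∀ n k c d → (n ℕ.+ suc k) ℕ.* c ℕ.+ ((c ℕ.+ d) ℕ.+ suc (n ℕ.+ k) ℕ.* d)
                       ≡ suc (n ℕ.+ suc k) ℕ.* (c ℕ.+ d)
  collect = solve-∀

multichoose-raise : ∀ n k → suc k ℕ.* multichoose n (suc k) ≡ n ℕ.* multichoose (suc n) k
multichoose-raise n k = trans (multichoose-absorb n k) (raise k)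
  where
  open ≡-Reasoning
  raise : ∀ k → (n ℕ.+ k) ℕ.* multichoose n k ≡ n ℕ.* multichoose (suc n) k
  raise zero    = cong (ℕ._* 1) (ℕₚ.+-identityʳ n)
  raise (suc k) = begin
    (n ℕ.+ suc k) ℕ.* c                       ≡⟨ ℕₚ.*-distribʳ-+ c n (suc k) ⟩
    n ℕ.* c ℕ.+ suc k ℕ.* c
      ≡⟨ cong (n ℕ.* c ℕ.+_) (trans (multichoose-absorb n k) (raise k)) ⟩
    n ℕ.* c ℕ.+ n ℕ.* multichoose (suc n) k   ≡⟨ ℕₚ.*-distribˡ-+ n c _ ⟨
    n ℕ.* multichoose (suc n) (suc k)         ∎
    where c = multichoose n (suc k)

surjections-vanish : ∀ {m k} → m < k → surjections m k ≡ 0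
surjections-vanish {zero}  {suc k} _         = refl
surjections-vanish {suc m} {suc k} (s<s m<k) = begin
  suc k ℕ.* (surjections m (suc k) ℕ.+ surjections m k)
    ≡⟨ cong₂ (λ x y → suc k ℕ.* (x ℕ.+ y)) (surjections-vanish (ℕₚ.m<n⇒m<1+n m<k)) (surjections-vanish m<k) ⟩
  suc k ℕ.* 0  ≡⟨ ℕₚ.*-zeroʳ (suc k) ⟩
  0            ∎
  where open ≡-Reasoning

-- delay k f lists the coefficients of x^k F, where f lists those of F.
delay : ℕ → (ℕ → ℕ) → ℕ → ℕ
delay zero    f j       = f j
delay (suc k) f zero    = 0
delay (suc k) f (suc j) = delay k f j

-- x D (x^k (1-x)^(-n)) = k x^k (1-x)^(-n) + n x^(k+1) (1-x)^(-n-1), coefficientwise.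
delay-derivative : ∀ n k j → j ℕ.* delay k (multichoose n) j
  ≡ k ℕ.* delay k (multichoose n) j ℕ.+ n ℕ.* delay (suc k) (multichoose (suc n)) j
delay-derivative n zero    zero    = sym (ℕₚ.*-zeroʳ n)
delay-derivative n zero    (suc j) = multichoose-raise n j
delay-derivative n (suc k) zero    = sym (trans (cong (ℕ._+ n ℕ.* 0) (ℕₚ.*-zeroʳ k)) (ℕₚ.*-zeroʳ n))
delay-derivative n (suc k) (suc j) =
  trans (cong (s ℕ.+_) (delay-derivative n k j)) (sym (ℕₚ.+-assoc s (k ℕ.* s) _))
  where s = delay k (multichoose n) j

sum-rotate : ∀ n (h : ℕ → ℕ) →
  h 0 ℕ.+ ℕΣ.sum {n} (λ i → h (suc (toℕ i))) ≡ ℕΣ.sum {n} (λ i → h (toℕ i)) ℕ.+ h n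
sum-rotate zero    h = ℕₚ.+-identityʳ (h 0)
sum-rotate (suc n) h =
  trans (cong (h 0 ℕ.+_) (sum-rotate n (h ∘ suc))) (sym (ℕₚ.+-assoc (h 0) _ _))

numerator : ℕ → ℕ → ℕ → ℕ
numerator n m k = surjections m k ℕ.* multichoose n k

power-expansion : ∀ n m j → j ℕ.^ m ℕ.* multichoose n j
  ≡ ℕΣ.sum {suc m} (λ k → numerator n m (toℕ k) ℕ.* delay (toℕ k) (multichoose (n ℕ.+ toℕ k)) j)
power-expansion n zero j rewrite ℕₚ.+-identityʳ n =
  sym (ℕₚ.+-identityʳ _)
power-expansion n (suc m) j = begin
  j ℕ.^ suc m ℕ.* multichoose n j
    ≡⟨ ℕₚ.*-assoc j (j ℕ.^ m) _ ⟩
  j ℕ.* (j ℕ.^ m ℕ.* multichoose n j)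
    ≡⟨ cong (j ℕ.*_) (power-expansion n m j) ⟩
  j ℕ.* ℕΣ.sum {suc m} (λ k → numerator n m (toℕ k) ℕ.* u (toℕ k))
    ≡⟨ ℕΣ.*-distribˡ-sum {suc m} j (λ k → numerator n m (toℕ k) ℕ.* u (toℕ k)) ⟩
  ℕΣ.sum {suc m} (λ k → j ℕ.* (numerator n m (toℕ k) ℕ.* u (toℕ k)))
    ≡⟨ ℕΣ.sum-cong-≗ {suc m} (λ k → differentiate (toℕ k)) ⟩
  ℕΣ.sum {suc m} (λ k → h (toℕ k) ℕ.+ g (toℕ k))
    ≡⟨ ℕΣ.∑-distrib-+ {suc m} (λ k → h (toℕ k)) (λ k → g (toℕ k)) ⟩
  ℕΣ.sum {suc m} (λ k → h (toℕ k)) ℕ.+ ℕΣ.sum {suc m} (λ k → g (toℕ k))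
    ≡⟨ cong (ℕ._+ ℕΣ.sum {suc m} (λ k → g (toℕ k))) rotated ⟩
  ℕΣ.sum {suc m} (λ k → h (suc (toℕ k))) ℕ.+ ℕΣ.sum {suc m} (λ k → g (toℕ k))
    ≡⟨ ℕΣ.∑-distrib-+ {suc m} (λ k → h (suc (toℕ k))) (λ k → g (toℕ k)) ⟨
  ℕΣ.sum {suc m} (λ k → h (suc (toℕ k)) ℕ.+ g (toℕ k))
    ≡⟨ ℕΣ.sum-cong-≗ {suc m} (λ k → recurrence (toℕ k)) ⟨
  ℕΣ.sum {suc m} (λ k → numerator n (suc m) (suc (toℕ k)) ℕ.* u (suc (toℕ k)))
    ∎
  where
  open ≡-Reasoning
  u h g : ℕ → ℕ
  u k = delay k (multichoose (n ℕ.+ k)) j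
  h k = k ℕ.* (numerator n m k ℕ.* u k)
  g k = (n ℕ.+ k) ℕ.* (numerator n m k ℕ.* u (suc k))

  differentiate : ∀ k → j ℕ.* (numerator n m k ℕ.* u k) ≡ h k ℕ.+ g k
  differentiate k rewrite ℕₚ.+-suc n k = begin
    j ℕ.* (a ℕ.* s)                          ≡⟨ swap j a s ⟩
    a ℕ.* (j ℕ.* s)                          ≡⟨ cong (a ℕ.*_) (delay-derivative (n ℕ.+ k) k j) ⟩
    a ℕ.* (k ℕ.* s ℕ.+ (n ℕ.+ k) ℕ.* s′)    ≡⟨ spread a k s (n ℕ.+ k) s′ ⟩
    k ℕ.* (a ℕ.* s) ℕ.+ (n ℕ.+ k) ℕ.* (a ℕ.* s′) ∎
    where
    a = numerator n m k
    s = u k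
    s′ = delay (suc k) (multichoose (suc (n ℕ.+ k))) j
    swap : ∀ x y z → x ℕ.* (y ℕ.* z) ≡ y ℕ.* (x ℕ.* z)
    swap = solve-∀
    spread : ∀ a k s p t → a ℕ.* (k ℕ.* s ℕ.+ p ℕ.* t) ≡ k ℕ.* (a ℕ.* s) ℕ.+ p ℕ.* (a ℕ.* t)
    spread = solve-∀

  rotated : ℕΣ.sum {suc m} (λ k → h (toℕ k)) ≡ ℕΣ.sum {suc m} (λ k → h (suc (toℕ k)))
  rotated = begin
    ℕΣ.sum {suc m} (λ k → h (toℕ k))               ≡⟨ ℕₚ.+-identityʳ _ ⟨
    ℕΣ.sum {suc m} (λ k → h (toℕ k)) ℕ.+ 0         ≡⟨ cong (ℕΣ.sum {suc m} (λ k → h (toℕ k)) ℕ.+_) last ⟨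
    ℕΣ.sum {suc m} (λ k → h (toℕ k)) ℕ.+ h (suc m) ≡⟨ sum-rotate (suc m) h ⟨
    ℕΣ.sum {suc m} (λ k → h (suc (toℕ k)))         ∎
    where
    last : h (suc m) ≡ 0
    last rewrite surjections-vanish (ℕₚ.n<1+n m) = ℕₚ.*-zeroʳ m

  recurrence : ∀ k → numerator n (suc m) (suc k) ℕ.* u (suc k) ≡ h (suc k) ℕ.+ g k
  recurrence k = begin
    suc k ℕ.* (x ℕ.+ y) ℕ.* c ℕ.* s
      ≡⟨ spread (suc k) x y c s ⟩
    suc k ℕ.* (x ℕ.* c ℕ.* s) ℕ.+ y ℕ.* (suc k ℕ.* c) ℕ.* s
      ≡⟨ cong (λ z → suc k ℕ.* (x ℕ.* c ℕ.* s) ℕ.+ y ℕ.* z ℕ.* s) (multichoose-absorb n k) ⟩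
    suc k ℕ.* (x ℕ.* c ℕ.* s) ℕ.+ y ℕ.* ((n ℕ.+ k) ℕ.* d) ℕ.* s
      ≡⟨ cong (suc k ℕ.* (x ℕ.* c ℕ.* s) ℕ.+_) (arrange y (n ℕ.+ k) d s) ⟩
    h (suc k) ℕ.+ g k
      ∎
    where
    x = surjections m (suc k)
    y = surjections m k
    c = multichoose n (suc k)
    d = multichoose n k
    s = u (suc k)
    spread : ∀ p x y c s → p ℕ.* (x ℕ.+ y) ℕ.* c ℕ.* s ≡ p ℕ.* (x ℕ.* c ℕ.* s) ℕ.+ y ℕ.* (p ℕ.* c) ℕ.* s
    spread = solve-∀
    arrange : ∀ y p d s → y ℕ.* (p ℕ.* d) ℕ.* s ≡ p ℕ.* (y ℕ.* d ℕ.* s)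
    arrange = solve-∀

ι : ℕ → ℚ
ι m = + m ℚ./ 1

toℚᵘ-ι : ∀ m → ℚ.toℚᵘ (ι m) ℚᵘ.≃ (+ m ℚᵘ./ 1)
toℚᵘ-ι m = ℚₚ.toℚᵘ-fromℚᵘ (+ m ℚᵘ./ 1)

ι-+ : ∀ m n → ι (m ℕ.+ n) ≡ ι m ℚ.+ ι n
ι-+ m n = ℚₚ.toℚᵘ-injective (begin
  ℚ.toℚᵘ (ι (m ℕ.+ n))                     ≈⟨ toℚᵘ-ι (m ℕ.+ n) ⟩
  + (m ℕ.+ n) ℚᵘ./ 1
    ≡⟨ cong (ℚᵘ._/ 1) (cong₂ (λ a b → + (a ℕ.+ b)) (sym (ℕₚ.*-identityʳ m)) (sym (ℕₚ.*-identityʳ n))) ⟩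
  + (m ℕ.* 1 ℕ.+ n ℕ.* 1) ℚᵘ./ 1
    ≡⟨ cong (ℚᵘ._/ 1) (trans (ℤₚ.pos-+ (m ℕ.* 1) (n ℕ.* 1)) (cong₂ (λ a b → a ℤ.+ b) (ℤₚ.pos-* m 1) (ℤₚ.pos-* n 1))) ⟩
  (+ m ℚᵘ./ 1) ℚᵘ.+ (+ n ℚᵘ./ 1)           ≈⟨ ℚᵘₚ.+-cong (toℚᵘ-ι m) (toℚᵘ-ι n) ⟨
  ℚ.toℚᵘ (ι m) ℚᵘ.+ ℚ.toℚᵘ (ι n)           ≈⟨ ℚₚ.toℚᵘ-homo-+ (ι m) (ι n) ⟨
  ℚ.toℚᵘ (ι m ℚ.+ ι n)                     ∎)
  where open ℚᵘₚ.≃-Reasoning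

ι-* : ∀ m n → ι (m ℕ.* n) ≡ ι m ℚ.* ι n
ι-* m n = ℚₚ.toℚᵘ-injective (begin
  ℚ.toℚᵘ (ι (m ℕ.* n))                     ≈⟨ toℚᵘ-ι (m ℕ.* n) ⟩
  + (m ℕ.* n) ℚᵘ./ 1                       ≡⟨ cong (ℚᵘ._/ 1) (ℤₚ.pos-* m n) ⟩
  (+ m ℚᵘ./ 1) ℚᵘ.* (+ n ℚᵘ./ 1)           ≈⟨ ℚᵘₚ.*-cong (toℚᵘ-ι m) (toℚᵘ-ι n) ⟨
  ℚ.toℚᵘ (ι m) ℚᵘ.* ℚ.toℚᵘ (ι n)           ≈⟨ ℚₚ.toℚᵘ-homo-* (ι m) (ι n) ⟨
  ℚ.toℚᵘ (ι m ℚ.* ι n)                     ∎)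
  where open ℚᵘₚ.≃-Reasoning

ι-sum : ∀ {n} (f : Fin n → ℕ) → ι (ℕΣ.sum f) ≡ ℚΣ.sum (ι ∘ f)
ι-sum {zero}  f = refl
ι-sum {suc n} f = trans (ι-+ (f zero) _) (cong (ι (f zero) ℚ.+_) (ι-sum (f ∘ suc)))

shift : Series → Series
shift f zero    = 0ℚ
shift f (suc m) = f m

*-cong : ∀ {f f′ g g′} → f ≈ f′ → g ≈ g′ → f * g ≈ f′ * g′
*-cong f≈f′ g≈g′ m = ℚΣ.sum-cong-≗ {suc m} (λ i → cong₂ ℚ._*_ (f≈f′ (toℕ i)) (g≈g′ (m ℕ.∸ toℕ i)))

shift-cong : ∀ {f g} → f ≈ g → shift f ≈ shift g
shift-cong f≈g zero    = refl
shift-cong f≈g (suc m) = f≈g m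

constant-* : ∀ c f m → (constant c * f) m ≡ c ℚ.* f m
constant-* c f m = begin
  c ℚ.* f m ℚ.+ ℚΣ.sum {m} (λ i → 0ℚ ℚ.* f (m ℕ.∸ suc (toℕ i)))
    ≡⟨ cong (c ℚ.* f m ℚ.+_) (ℚΣ.*-distribˡ-sum {m} 0ℚ (λ i → f (m ℕ.∸ suc (toℕ i)))) ⟨
  c ℚ.* f m ℚ.+ 0ℚ ℚ.* ℚΣ.sum {m} (λ i → f (m ℕ.∸ suc (toℕ i)))
    ≡⟨ cong (c ℚ.* f m ℚ.+_) (ℚₚ.*-zeroˡ (ℚΣ.sum {m} (λ i → f (m ℕ.∸ suc (toℕ i))))) ⟩
  c ℚ.* f m ℚ.+ 0ℚ  ≡⟨ ℚₚ.+-identityʳ _ ⟩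
  c ℚ.* f m         ∎
  where open ≡-Reasoning

*-shiftˡ : ∀ f g → shift f * g ≈ shift (f * g)
*-shiftˡ f g zero    = trans (ℚₚ.+-identityʳ _) (ℚₚ.*-zeroˡ (g 0))
*-shiftˡ f g (suc m) = trans (cong (ℚ._+ (f * g) m) (ℚₚ.*-zeroˡ (g (suc m)))) (ℚₚ.+-identityˡ _)

X≈shift : X ≈ shift 1#
X≈shift zero          = refl
X≈shift (suc zero)    = refl
X≈shift (suc (suc m)) = refl

X-* : ∀ f → X * f ≈ shift f
X-* f m = begin
  (X * f) m         ≡⟨ *-cong {g = f} X≈shift (λ _ → refl) m ⟩
  (shift 1# * f) m  ≡⟨ *-shiftˡ 1# f m ⟩
  shift (1# * f) m  ≡⟨ shift-cong (λ i → trans (constant-* 1ℚ f i) (ℚₚ.*-identityˡ (f i))) m ⟩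
  shift f m         ∎
  where open ≡-Reasoning

monomial : ∀ c k → constant c * X ^ k ≈ fold (constant c) shift k
monomial c zero    m = begin
  (constant c * 1#) m  ≡⟨ constant-* c 1# m ⟩
  c ℚ.* 1# m           ≡⟨ unit m ⟩
  constant c m         ∎
  where
  open ≡-Reasoning
  unit : ∀ m → c ℚ.* 1# m ≡ constant c m
  unit zero    = ℚₚ.*-identityʳ c
  unit (suc m) = ℚₚ.*-zeroʳ c
monomial c (suc k) m = begin
  (constant c * (X * X ^ k)) m  ≡⟨ constant-* c (X * X ^ k) m ⟩
  c ℚ.* (X * X ^ k) m           ≡⟨ cong (c ℚ.*_) (X-* (X ^ k) m) ⟩
  c ℚ.* shift (X ^ k) m         ≡⟨ scale m ⟩
  shift (fold (constant c) shift k) m ∎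
  where
  open ≡-Reasoning
  scale : ∀ m → c ℚ.* shift (X ^ k) m ≡ shift (fold (constant c) shift k) m
  scale zero    = ℚₚ.*-zeroʳ c
  scale (suc m) = trans (sym (constant-* c (X ^ k) m)) (monomial c k m)

monomial-* : ∀ c k f m → (constant c * X ^ k * f) m ≡ c ℚ.* fold f shift k m
monomial-* c k f m =
  trans (*-cong {g = f} (monomial c k) (λ _ → refl) m) (shifted k m)
  where
  shifted : ∀ k m → (fold (constant c) shift k * f) m ≡ c ℚ.* fold f shift k m
  shifted zero    m       = constant-* c f m
  shifted (suc k) zero    = trans (*-shiftˡ (fold (constant c) shift k) f zero) (sym (ℚₚ.*-zeroʳ c))
  shifted (suc k) (suc m) = trans (*-shiftˡ (fold (constant c) shift k) f (suc m)) (shifted k m)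

geometric-* : ∀ f m → ([1-X]⁻¹ * f) (suc m) ≡ f (suc m) ℚ.+ ([1-X]⁻¹ * f) m
geometric-* f m = cong (ℚ._+ ([1-X]⁻¹ * f) m) (ℚₚ.*-identityˡ (f (suc m)))

geometric-power : ∀ n j → ([1-X]⁻¹ ^ n) j ≡ ι (multichoose n j)
geometric-power zero    zero    = refl
geometric-power zero    (suc j) = refl
geometric-power (suc n) zero    =
  trans (ℚₚ.+-identityʳ _) (trans (ℚₚ.*-identityˡ (([1-X]⁻¹ ^ n) 0)) (geometric-power n 0))
geometric-power (suc n) (suc j) = begin
  ([1-X]⁻¹ * [1-X]⁻¹ ^ n) (suc j)
    ≡⟨ geometric-* ([1-X]⁻¹ ^ n) j ⟩
  ([1-X]⁻¹ ^ n) (suc j) ℚ.+ ([1-X]⁻¹ ^ suc n) j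
    ≡⟨ cong₂ ℚ._+_ (geometric-power n (suc j)) (geometric-power (suc n) j) ⟩
  ι (multichoose n (suc j)) ℚ.+ ι (multichoose (suc n) j)
    ≡⟨ ι-+ (multichoose n (suc j)) (multichoose (suc n) j) ⟨
  ι (multichoose (suc n) (suc j))
    ∎
  where open ≡-Reasoning

fold-shift-ι : ∀ {f : Series} {g} → (∀ j → f j ≡ ι (g j)) → ∀ k j → fold f shift k j ≡ ι (delay k g j)
fold-shift-ι f≡g zero    j       = f≡g j
fold-shift-ι f≡g (suc k) zero    = refl
fold-shift-ι f≡g (suc k) (suc j) = fold-shift-ι f≡g k j

xD-coefficient : ∀ f j → xD f j ≡ ι j ℚ.* f j
xD-coefficient f zero    = trans (X-* (D f) 0) (sym (ℚₚ.*-zeroˡ (f 0)))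
xD-coefficient f (suc j) = X-* (D f) (suc j)

xD-power : ∀ f m j → fold f xD m j ≡ ι (j ℕ.^ m) ℚ.* f j
xD-power f zero    j = sym (ℚₚ.*-identityˡ (f j))
xD-power f (suc m) j = begin
  xD (fold f xD m) j                ≡⟨ xD-coefficient (fold f xD m) j ⟩
  ι j ℚ.* fold f xD m j             ≡⟨ cong (ι j ℚ.*_) (xD-power f m j) ⟩
  ι j ℚ.* (ι (j ℕ.^ m) ℚ.* f j)     ≡⟨ ℚₚ.*-assoc (ι j) (ι (j ℕ.^ m)) (f j) ⟨
  ι j ℚ.* ι (j ℕ.^ m) ℚ.* f j       ≡⟨ cong (ℚ._* f j) (ι-* j (j ℕ.^ m)) ⟨
  ι (j ℕ.^ suc m) ℚ.* f j           ∎
  where open ≡-Reasoning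

sum-coefficient : ∀ {n} (F : Fin n → Series) j → sum F j ≡ ℚΣ.sum (λ i → F i j)
sum-coefficient {zero}  F zero    = refl
sum-coefficient {zero}  F (suc j) = refl
sum-coefficient {suc n} F j       = cong (F zero j ℚ.+_) (sum-coefficient (F ∘ suc) j)

sum-ι-* : ∀ {n} (f g : Fin n → ℕ) → ι (ℕΣ.sum (λ i → f i ℕ.* g i)) ≡ ℚΣ.sum (λ i → ι (f i) ℚ.* ι (g i))
sum-ι-* {n} f g = trans (ι-sum (λ i → f i ℕ.* g i)) (ℚΣ.sum-cong-≗ {n} (λ i → ι-* (f i) (g i)))

fraction-coefficient : ∀ n (a : Fin n → ℚ) j →
  sum (λ k → constant (a k) * X ^ toℕ k * [1-X]⁻¹ ^ (n ℕ.+ toℕ k)) j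
    ≡ ℚΣ.sum (λ k → a k ℚ.* ι (delay (toℕ k) (multichoose (n ℕ.+ toℕ k)) j))
fraction-coefficient n a j = trans
  (sum-coefficient (λ k → constant (a k) * X ^ toℕ k * [1-X]⁻¹ ^ (n ℕ.+ toℕ k)) j)
  (ℚΣ.sum-cong-≗ {n} (λ k → trans
    (monomial-* (a k) (toℕ k) ([1-X]⁻¹ ^ (n ℕ.+ toℕ k)) j)
    (cong (a k ℚ.*_) (fold-shift-ι (geometric-power (n ℕ.+ toℕ k)) (toℕ k) j))))

numerators : ∀ m → Fin (suc m) → ℚ
numerators m k = ι (numerator (suc m) m (toℕ k))

expansion-exists : ∀ m → IsSimpleFractionExpansion (suc m) (numerators m)
expansion-exists m j = begin
  fold ([1-X]⁻¹ ^ n) xD m j                        ≡⟨ xD-power ([1-X]⁻¹ ^ n) m j ⟩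
  ι (j ℕ.^ m) ℚ.* ([1-X]⁻¹ ^ n) j                  ≡⟨ cong (ι (j ℕ.^ m) ℚ.*_) (geometric-power n j) ⟩
  ι (j ℕ.^ m) ℚ.* ι (multichoose n j)              ≡⟨ ι-* (j ℕ.^ m) (multichoose n j) ⟨
  ι (j ℕ.^ m ℕ.* multichoose n j)                  ≡⟨ cong ι (power-expansion n m j) ⟩
  ι (ℕΣ.sum (λ k → a k ℕ.* u k))                   ≡⟨ sum-ι-* a u ⟩
  ℚΣ.sum (λ k → ι (a k) ℚ.* ι (u k))               ≡⟨ fraction-coefficient n (ι ∘ a) j ⟨
  sum (λ k → constant (ι (a k)) * X ^ toℕ k * [1-X]⁻¹ ^ (n ℕ.+ toℕ k)) j ∎
  where
  open ≡-Reasoning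
  n = suc m
  a u : Fin n → ℕ
  a k = numerator n m (toℕ k)
  u k = delay (toℕ k) (multichoose (n ℕ.+ toℕ k)) j

triangular-unique : ∀ {n} (u : Fin n → ℕ → ℚ) →
  (∀ k {j} → j < toℕ k → u k j ≡ 0ℚ) → (∀ k → u k (toℕ k) ≡ 1ℚ) →
  (a b : Fin n → ℚ) → (∀ j → ℚΣ.sum (λ k → a k ℚ.* u k j) ≡ ℚΣ.sum (λ k → b k ℚ.* u k j)) → a ≗ b
triangular-unique {suc n} u below diagonal a b eq = λ
  { zero    → head
  ; (suc k) → triangular-unique (λ k j → u (suc k) (suc j))
      (λ k j<k → below (suc k) (s<s j<k)) (diagonal ∘ suc) (a ∘ suc) (b ∘ suc) rest k
  }
  where
  open ≡-Reasoning
  head-coefficient : ∀ c → ℚΣ.sum (λ k → c k ℚ.* u k 0) ≡ c zero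
  head-coefficient c = begin
    c zero ℚ.* u zero 0 ℚ.+ ℚΣ.sum (λ k → c (suc k) ℚ.* u (suc k) 0)
      ≡⟨ cong₂ (λ x y → c zero ℚ.* x ℚ.+ y) (diagonal zero)
           (ℚΣ.sum-cong-≗ {n} (λ k → trans (cong (c (suc k) ℚ.*_) (below (suc k) z<s)) (ℚₚ.*-zeroʳ (c (suc k))))) ⟩
    c zero ℚ.* 1ℚ ℚ.+ ℚΣ.sum {n} (λ _ → 0ℚ)
      ≡⟨ cong₂ ℚ._+_ (ℚₚ.*-identityʳ (c zero)) (ℚΣ.sum-replicate-zero n) ⟩
    c zero ℚ.+ 0ℚ  ≡⟨ ℚₚ.+-identityʳ (c zero) ⟩
    c zero         ∎

  head : a zero ≡ b zero
  head = trans (sym (head-coefficient a)) (trans (eq 0) (head-coefficient b))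

  rest : ∀ j → ℚΣ.sum (λ k → a (suc k) ℚ.* u (suc k) (suc j)) ≡ ℚΣ.sum (λ k → b (suc k) ℚ.* u (suc k) (suc j))
  rest j = GroupProperties.∙-cancelˡ ℚₚ.+-0-group (b zero ℚ.* u zero (suc j)) _ _
    (trans (cong (λ x → x ℚ.* u zero (suc j) ℚ.+ ℚΣ.sum (λ k → a (suc k) ℚ.* u (suc k) (suc j))) (sym head)) (eq (suc j)))

delay-below : ∀ {k j} f → j < k → delay k f j ≡ 0
delay-below {suc k} {zero}  f _         = refl
delay-below {suc k} {suc j} f (s<s j<k) = delay-below f j<k

delay-diagonal : ∀ k f → delay k f k ≡ f 0
delay-diagonal zero    f = refl
delay-diagonal (suc k) f = delay-diagonal k f

expansion-unique : ∀ n a b → IsSimpleFractionExpansion n a → IsSimpleFractionExpansion n b → a ≗ b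
expansion-unique n a b a-expands b-expands =
  triangular-unique (λ k j → ι (delay (toℕ k) (multichoose (n ℕ.+ toℕ k)) j))
    (λ k j<k → cong ι (delay-below (multichoose (n ℕ.+ toℕ k)) j<k))
    (λ k → cong ι (delay-diagonal (toℕ k) (multichoose (n ℕ.+ toℕ k)))) a b
    (λ j → trans (sym (fraction-coefficient n a j))
             (trans (sym (a-expands j)) (trans (b-expands j) (fraction-coefficient n b j))))

polynomial-cong : ∀ {n} (a b : Fin n → ℚ) → a ≗ b → polynomial a ≈ polynomial b
polynomial-cong {n} a b a≗b j = begin
  polynomial a j                                   ≡⟨ sum-coefficient (λ k → constant (a k) * X ^ toℕ k) j ⟩
  ℚΣ.sum (λ k → (constant (a k) * X ^ toℕ k) j)    ≡⟨ ℚΣ.sum-cong-≗ {n} (λ k → cong (λ c → (constant c * X ^ toℕ k) j) (a≗b k)) ⟩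
  ℚΣ.sum (λ k → (constant (b k) * X ^ toℕ k) j)    ≡⟨ sum-coefficient (λ k → constant (b k) * X ^ toℕ k) j ⟨
  polynomial b j                                   ∎
  where open ≡-Reasoning

-- Trees with prescribed numbers of blocks

module _ {A : Set} (S : Setoid 0ℓ 0ℓ) where
  open Setoid S using (Carrier) renaming (_≈_ to _≋_; reflexive to ≋-reflexive)

  mkBijection : (f : A → Carrier) → Injective _≡_ _≋_ f → StrictlySurjective _≋_ f →
                Bijection (setoid A) S
  mkBijection f injective surjective = record
    { to        = f
    ; cong      = ≋-reflexive ∘ cong f
    ; bijective = injective , λ y → let x , fx≈y = surjective y in x , λ { refl → fx≈y }
    }

-- An enriched tree with k blocks in all, numbered once and for all: owner s is
-- the parent of the vertices in the s-th block, and full says that no block is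
-- empty.
record SlotTree {n k} (owner : Fin k → Fin n) : Set where
  field
    root      : Fin n
    slot      : Fin n → Maybe (Fin k)
    root-free : slot root ≡ nothing
    connected : ∀ v → Star (λ u w → Maybe.map owner (slot u) ≡ just w) v root
    full      : ∀ s → ∃[ u ] slot u ≡ just s

open SlotTree

slotTrees : ∀ {n k} → (Fin k → Fin n) → Setoid 0ℓ 0ℓ
slotTrees owner = record
  { Carrier       = SlotTree owner
  ; _≈_           = λ t t′ → root t ≡ root t′ × slot t ≗ slot t′
  ; isEquivalence = record
    { refl  = refl , λ _ → refl
    ; sym   = λ (p , q) → sym p , sym ∘ q
    ; trans = λ (p , q) (p′ , q′) → trans p p′ , λ v → trans (q v) (q′ v)
    }
  }

slotCount-bound : ∀ {m k} {owner : Fin k → Fin (suc m)} → SlotTree owner → k ≤ m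
slotCount-bound {m} {k} t = s≤s⁻¹ (Finₚ.injective⇒≤ {f = occupant} (λ {x} {y} → occupant-injective x y))
  where
  occupant : Fin (suc k) → Fin (suc m)
  occupant zero    = root t
  occupant (suc s) = proj₁ (full t s)

  occupant-injective : ∀ x y → occupant x ≡ occupant y → x ≡ y
  occupant-injective zero    zero    _  = refl
  occupant-injective zero    (suc s) eq =
    contradiction (trans (sym (root-free t)) (trans (cong (slot t) eq) (proj₂ (full t s)))) λ()
  occupant-injective (suc s) zero    eq =
    contradiction (trans (sym (proj₂ (full t s))) (trans (cong (slot t) eq) (root-free t))) λ()
  occupant-injective (suc r) (suc s) eq = cong suc (Maybeₚ.just-injective
    (trans (sym (proj₂ (full t r))) (trans (cong (slot t) eq) (proj₂ (full t s)))))

∃-unused : ∀ {n k} → k < n → (owner : Fin k → Fin n) → ∃[ l ] (∀ r → l ≢ owner r)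
∃-unused {n} {k} k<n owner with Finₚ.any? (λ l → ¬? (Finₚ.any? (λ r → l Finₚ.≟ owner r)))
... | yes (l , l-unused) = l , λ r l≡r → l-unused (r , l≡r)
... | no  all-used       = contradiction k<n (ℕₚ.≤⇒≯ (Finₚ.injective⇒≤ {f = proj₁ ∘ used}
        (λ {x} {y} eq → trans (proj₂ (used x)) (trans (cong owner eq) (sym (proj₂ (used y)))))))
  where
  used : ∀ l → ∃[ r ] l ≡ owner r
  used l = decidable-stable (Finₚ.any? (λ r → l Finₚ.≟ owner r)) (λ l-unused → all-used (l , l-unused))

punchIn-view : ∀ {n} (l v : Fin (suc n)) → v ≡ l ⊎ ∃[ u ] v ≡ punchIn l u
punchIn-view l v with l Finₚ.≟ v
... | yes l≡v = inj₁ (sym l≡v)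
... | no  l≢v = inj₂ (punchOut l≢v , sym (Finₚ.punchIn-punchOut l≢v))

-- A slot tree in which the leaf l occupies the slot s, against the slot tree
-- left when l is removed.  The remaining slots are embedded by g, which omits s
-- when l was its only occupant.
module LeafRemoval
  {n k k′} {owner : Fin k → Fin (suc n)} {owner′ : Fin k′ → Fin n}
  (l : Fin (suc n)) (l-unused : ∀ r → l ≢ owner r) (s : Fin k)
  (g : Fin k′ → Fin k) (g-injective : Injective _≡_ _≡_ g)
  (owner-g : ∀ j → owner (g j) ≡ punchIn l (owner′ j))
  where

  module _ (t : SlotTree owner′) where

    grownSlot : Fin (suc n) → Maybe (Fin k)
    grownSlot = Vector.insertAt (Maybe.map g ∘ slot t) l (just s)

    grownSlot-leaf : grownSlot l ≡ just s
    grownSlot-leaf = insertAt-lookup (Maybe.map g ∘ slot t) l (just s)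

    grownSlot-punchIn : ∀ u → grownSlot (punchIn l u) ≡ Maybe.map g (slot t u)
    grownSlot-punchIn = insertAt-punchIn (Maybe.map g ∘ slot t) l (just s)

    grow : (∀ r → r ≡ s ⊎ ∃[ j ] g j ≡ r) → SlotTree owner
    grow g-covers = record
      { root      = punchIn l (root t)
      ; slot      = grownSlot
      ; root-free = trans (grownSlot-punchIn (root t)) (Maybeₚ.map-nothing (root-free t))
      ; connected = reach
      ; full      = occupied
      }
      where
      Edge : Fin (suc n) → Fin (suc n) → Set
      Edge u w = Maybe.map owner (grownSlot u) ≡ just w

      lift-edge : ∀ {u w} → Maybe.map owner′ (slot t u) ≡ just w → Edge (punchIn l u) (punchIn l w)
      lift-edge {u} edge rewrite grownSlot-punchIn u with slot t u | edge
      ... | just j | refl = cong just (owner-g j)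

      reach-punchIn : ∀ {u w} → Star (λ u w → Maybe.map owner′ (slot t u) ≡ just w) u w →
                      Star Edge (punchIn l u) (punchIn l w)
      reach-punchIn ε            = ε
      reach-punchIn (edge ◅ path) = lift-edge edge ◅ reach-punchIn path

      reach : ∀ v → Star Edge v (punchIn l (root t))
      reach v with punchIn-view l v
      ... | inj₂ (u , refl) = reach-punchIn (connected t u)
      ... | inj₁ refl       =
        trans (cong (Maybe.map owner) grownSlot-leaf)
              (cong just (sym (Finₚ.punchIn-punchOut (l-unused s))))
        ◅ reach-punchIn (connected t (punchOut (l-unused s)))

      occupied : ∀ r → ∃[ u ] grownSlot u ≡ just r
      occupied r with g-covers r
      ... | inj₁ refl       = l , grownSlot-leaf
      ... | inj₂ (j , refl) =
        let u , u-in-j = full t j in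
        punchIn l u , trans (grownSlot-punchIn u) (Maybeₚ.map-just u-in-j)

  grownSlot-injective : ∀ t t′ → grownSlot t ≗ grownSlot t′ → slot t ≗ slot t′
  grownSlot-injective t t′ eq u = Maybeₚ.map-injective g-injective
    (trans (sym (grownSlot-punchIn t u)) (trans (eq (punchIn l u)) (grownSlot-punchIn t′ u)))

  module _
    (t : SlotTree owner) (leaf-in-s : slot t l ≡ just s)
    (slot′ : Fin n → Maybe (Fin k′)) (slot′-g : ∀ u → Maybe.map g (slot′ u) ≡ slot t (punchIn l u))
    (g-full : ∀ j → ∃[ u ] slot t (punchIn l u) ≡ just (g j))
    where

    l≢root : l ≢ root t
    l≢root l≡root = contradiction
      (trans (sym leaf-in-s) (trans (cong (slot t) l≡root) (root-free t))) λ()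

    shrink : SlotTree owner′
    shrink = record
      { root      = punchOut l≢root
      ; slot      = slot′
      ; root-free = Maybeₚ.map-injective g-injective (trans (slot′-g _)
          (trans (cong (slot t) (Finₚ.punchIn-punchOut l≢root)) (root-free t)))
      ; connected = λ u → descend (connected t (punchIn l u)) refl (sym (Finₚ.punchIn-punchOut l≢root))
      ; full      = λ j → let u , u-in-gj = g-full j in
          u , Maybeₚ.map-injective g-injective (trans (slot′-g u) u-in-gj)
      }
      where
      Edge′ : Fin n → Fin n → Set
      Edge′ u w = Maybe.map owner′ (slot′ u) ≡ just w

      lower-edge : ∀ u {z} → Maybe.map owner (slot t (punchIn l u)) ≡ just z →
                   ∃[ w ] z ≡ punchIn l w × Edge′ u w
      lower-edge u edge with slot′ u | slot t (punchIn l u) | slot′-g u | edge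
      ... | just j | _ | refl | refl = owner′ j , owner-g j , refl

      descend : ∀ {x y} → Star (λ u w → Maybe.map owner (slot t u) ≡ just w) x y →
                ∀ {u w} → x ≡ punchIn l u → y ≡ punchIn l w → Star Edge′ u w
      descend ε {u} {w} refl y≡w rewrite Finₚ.punchIn-injective l u w y≡w = ε
      descend (edge ◅ path) {u} refl y≡w with lower-edge u edge
      ... | _ , z≡ , edge′ = edge′ ◅ descend path z≡ y≡w

    grow-shrink : ∀ {t′ : SlotTree owner′} → root t′ ≡ punchOut l≢root → slot t′ ≗ slot′ →
                  punchIn l (root t′) ≡ root t × grownSlot t′ ≗ slot t
    grow-shrink {t′} root≡ slot≗ =
      trans (cong (punchIn l) root≡) (Finₚ.punchIn-punchOut l≢root) , same
      where
      same : grownSlot t′ ≗ slot t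
      same v with punchIn-view l v
      ... | inj₁ refl       = trans (grownSlot-leaf t′) (sym leaf-in-s)
      ... | inj₂ (u , refl) =
        trans (grownSlot-punchIn t′ u) (trans (cong (Maybe.map g) (slot≗ u)) (slot′-g u))

unused-occupies : ∀ {m k} {owner : Fin k → Fin (suc (suc m))} (t : SlotTree owner) l →
                  (∀ r → l ≢ owner r) → ∃[ s ] slot t l ≡ just s
unused-occupies {owner = owner} t l l-unused with slot t l in free
... | just s  = s , refl
... | nothing = contradiction (connected t (punchIn l zero)) (unreachable (Finₚ.punchInᵢ≢i l zero) (is-root (connected t l)))
  where
  Path : Fin _ → Fin _ → Set
  Path = Star (λ u w → Maybe.map owner (slot t u) ≡ just w)

  is-root : ∀ {y} → Path l y → y ≡ l
  is-root ε          = refl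
  is-root (edge ◅ _) rewrite free = contradiction edge λ()

  unreachable : ∀ {x y} → x ≢ l → y ≡ l → ¬ Path x y
  unreachable x≢l y≡l ε = x≢l y≡l
  unreachable {x} x≢l y≡l (edge ◅ path) with slot t x | edge
  ... | just r | refl = unreachable (l-unused r ∘ sym) y≡l path

punchIn-preimage : ∀ {k} {A : Set} (s : Fin (suc k)) (f : A → Maybe (Fin (suc k))) →
  (∀ u → f u ≢ just s) → ∀ u → ∃[ y ] Maybe.map (punchIn s) y ≡ f u
punchIn-preimage s f misses u with f u in eq
... | nothing = nothing , refl
... | just r  with punchIn-view s r
...   | inj₁ refl       = contradiction eq (misses u)
...   | inj₂ (j , refl) = just j , refl

map-punchIn-misses : ∀ {k} (s : Fin (suc k)) y → Maybe.map (punchIn s) y ≢ just s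
map-punchIn-misses s (just j) eq = Finₚ.punchInᵢ≢i s j (Maybeₚ.just-injective eq)

module _ {m k} {owner : Fin (suc k) → Fin (suc (suc m))}
  (l : Fin (suc (suc m))) (l-unused : ∀ r → l ≢ owner r) where

  restrictedOwner : Fin (suc k) → Fin (suc m)
  restrictedOwner r = punchOut (l-unused r)

  removeLeaf : {A B : Set} →
    Bijection (setoid A) (slotTrees restrictedOwner) →
    (∀ s → Bijection (setoid B) (slotTrees (restrictedOwner ∘ punchIn s))) →
    Bijection (setoid (Fin (suc k) × (A ⊎ B))) (slotTrees owner)
  removeLeaf {A} {B} shared alone = mkBijection (slotTrees owner) build build-injective build-surjective
    where
    owner-restricted : ∀ r → owner r ≡ punchIn l (restrictedOwner r)
    owner-restricted r = sym (Finₚ.punchIn-punchOut (l-unused r))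

    module Shared s = LeafRemoval {owner = owner} {owner′ = restrictedOwner} l l-unused s id id owner-restricted
    module Alone s = LeafRemoval {owner = owner} {owner′ = restrictedOwner ∘ punchIn s} l l-unused s
      (punchIn s) (λ {i} {j} → Finₚ.punchIn-injective s i j) (owner-restricted ∘ punchIn s)

    covers : ∀ s r → r ≡ s ⊎ ∃[ j ] punchIn s j ≡ r
    covers s r with punchIn-view s r
    ... | inj₁ r≡s       = inj₁ r≡s
    ... | inj₂ (j , r≡j) = inj₂ (j , sym r≡j)

    build : Fin (suc k) × (A ⊎ B) → SlotTree owner
    build (s , inj₁ a) = Shared.grow s (Bijection.to shared a) (λ r → inj₂ (r , refl))
    build (s , inj₂ b) = Alone.grow s (Bijection.to (alone s) b) (covers s)

    leaf-slot : ∀ c → slot (build c) l ≡ just (proj₁ c)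
    leaf-slot (s , inj₁ a) = Shared.grownSlot-leaf s (Bijection.to shared a)
    leaf-slot (s , inj₂ b) = Alone.grownSlot-leaf s (Bijection.to (alone s) b)

    shared≉alone : ∀ s a b → ¬ slot (build (s , inj₁ a)) ≗ slot (build (s , inj₂ b))
    shared≉alone s a b eq =
      let t       = Bijection.to shared a
          t′      = Bijection.to (alone s) b
          u , u∈s = full t s
      in map-punchIn-misses s (slot t′ u)
           (trans (sym (Alone.grownSlot-punchIn s t′ u))
             (trans (sym (eq (punchIn l u)))
               (trans (Shared.grownSlot-punchIn s t u) (Maybeₚ.map-just u∈s))))

    build-injective : Injective _≡_ (Setoid._≈_ (slotTrees owner)) build
    build-injective {s , x} {s′ , x′} (root≡ , slot≗)
      with Maybeₚ.just-injective (trans (sym (leaf-slot (s , x))) (trans (slot≗ l) (leaf-slot (s′ , x′))))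
    build-injective {s , inj₁ a} {_ , inj₁ a′} (root≡ , slot≗) | refl =
      cong (λ a → s , inj₁ a) (Bijection.injective shared
        (Finₚ.punchIn-injective l _ _ root≡ , Shared.grownSlot-injective s (Bijection.to shared a) (Bijection.to shared a′) slot≗))
    build-injective {s , inj₂ b} {_ , inj₂ b′} (root≡ , slot≗) | refl =
      cong (λ b → s , inj₂ b) (Bijection.injective (alone s)
        (Finₚ.punchIn-injective l _ _ root≡ , Alone.grownSlot-injective s (Bijection.to (alone s) b) (Bijection.to (alone s) b′) slot≗))
    build-injective {s , inj₁ a} {_ , inj₂ b} (_ , slot≗) | refl =
      contradiction slot≗ (shared≉alone s a b)
    build-injective {s , inj₂ b} {_ , inj₁ a} (_ , slot≗) | refl =
      contradiction (sym ∘ slot≗) (shared≉alone s a b)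

    build-surjective : StrictlySurjective (Setoid._≈_ (slotTrees owner)) build
    build-surjective t with unused-occupies t l l-unused
    ... | s , l∈s with Finₚ.any? (λ u → Maybeₚ.≡-dec Finₚ._≟_ (slot t (punchIn l u)) (just s))
    ...   | yes (u , u∈s) =
      let a , (root≡ , slot≗) = Bijection.strictlySurjective shared (Shared.shrink s t l∈s slot′ slot′-id g-full)
      in (s , inj₁ a) , Shared.grow-shrink s t l∈s slot′ slot′-id g-full {Bijection.to shared a} root≡ slot≗
      where
      slot′ : Fin (suc m) → Maybe (Fin (suc k))
      slot′ = slot t ∘ punchIn l

      slot′-id : ∀ v → Maybe.map id (slot′ v) ≡ slot t (punchIn l v)
      slot′-id v = Maybeₚ.map-id (slot′ v)

      g-full : ∀ j → ∃[ v ] slot t (punchIn l v) ≡ just j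
      g-full j with full t j
      ... | v , v∈j with punchIn-view l v
      ...   | inj₂ (w , refl) = w , v∈j
      ...   | inj₁ refl       = u , trans u∈s (trans (sym l∈s) v∈j)
    ...   | no s-missed =
      let b , (root≡ , slot≗) = Bijection.strictlySurjective (alone s) (Alone.shrink s t l∈s slot′ slot′-g g-full)
      in (s , inj₂ b) , Alone.grow-shrink s t l∈s slot′ slot′-g g-full {Bijection.to (alone s) b} root≡ slot≗
      where
      preimage : ∀ v → ∃[ y ] Maybe.map (punchIn s) y ≡ slot t (punchIn l v)
      preimage = punchIn-preimage s (slot t ∘ punchIn l) (λ u u∈s → s-missed (u , u∈s))

      slot′ : Fin (suc m) → Maybe (Fin k)
      slot′ = proj₁ ∘ preimage

      slot′-g : ∀ v → Maybe.map (punchIn s) (slot′ v) ≡ slot t (punchIn l v)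
      slot′-g = proj₂ ∘ preimage

      g-full : ∀ j → ∃[ v ] slot t (punchIn l v) ≡ just (punchIn s j)
      g-full j with full t (punchIn s j)
      ... | v , v∈j with punchIn-view l v
      ...   | inj₂ (w , refl) = w , v∈j
      ...   | inj₁ refl       =
        contradiction (Maybeₚ.just-injective (trans (sym v∈j) l∈s)) (Finₚ.punchInᵢ≢i s j)

SurjectionCode : ℕ → ℕ → Set
SurjectionCode zero    zero    = ⊤
SurjectionCode zero    (suc k) = ⊥
SurjectionCode (suc m) zero    = ⊥
SurjectionCode (suc m) (suc k) = Fin (suc k) × (SurjectionCode m (suc k) ⊎ SurjectionCode m k)

code-bound : ∀ m k → SurjectionCode m k → k ≤ m
code-bound zero    zero    _            = z≤n
code-bound (suc m) (suc k) (_ , inj₁ c) = ℕₚ.m≤n⇒m≤1+n (code-bound m (suc k) c)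
code-bound (suc m) (suc k) (_ , inj₂ c) = s≤s (code-bound m k c)

slotTree-codes : ∀ m k (owner : Fin k → Fin (suc m)) →
                 Bijection (setoid (SurjectionCode m k)) (slotTrees owner)
slotTree-codes zero zero owner = mkBijection (slotTrees owner) (λ _ → point) (λ _ → refl) (λ t → tt , unique t)
  where
  point : SlotTree owner
  point = record
    { root = zero ; slot = λ _ → nothing ; root-free = refl ; connected = λ { zero → ε } ; full = λ () }

  unique : ∀ t → Setoid._≈_ (slotTrees owner) point t
  unique t with root t | root-free t
  ... | zero | free = refl , λ { zero → sym free }
slotTree-codes zero (suc k) owner =
  mkBijection (slotTrees owner) (λ ()) (λ { {()} }) (λ t → contradiction (slotCount-bound t) λ())
slotTree-codes (suc m) zero owner =
  mkBijection (slotTrees owner) (λ ()) (λ { {()} })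
    (λ t → contradiction (proj₁ (unused-occupies t zero λ ())) λ())
slotTree-codes (suc m) (suc k) owner with k ℕₚ.≤? m
... | yes k≤m =
  let l , l-unused = ∃-unused (s≤s (s≤s k≤m)) owner in
  removeLeaf l l-unused
    (slotTree-codes m (suc k) (restrictedOwner l l-unused))
    (λ s → slotTree-codes m k (restrictedOwner l l-unused ∘ punchIn s))
... | no  k≰m = mkBijection (slotTrees owner)
  (λ c → contradiction (s≤s⁻¹ (code-bound (suc m) (suc k) c)) k≰m)
  (λ {c} → contradiction (s≤s⁻¹ (code-bound (suc m) (suc k) c)) k≰m)
  (λ t → contradiction (s≤s⁻¹ (slotCount-bound t)) k≰m)

-- Distributing the blocks over the vertices

-- A composition of k into n parts, read as a lattice path: take adds a unit to
-- the current part, next closes it.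
data WeakComposition : ℕ → ℕ → Set where
  end  : WeakComposition 0 0
  next : ∀ {n k} → WeakComposition n k → WeakComposition (suc n) k
  take : ∀ {n k} → WeakComposition (suc n) k → WeakComposition (suc n) (suc k)

owner : ∀ {n k} → WeakComposition n k → Fin k → Fin n
owner (next c) s       = suc (owner c s)
owner (take c) zero    = zero
owner (take c) (suc s) = owner c s

distribute : ∀ {n k} {A : Set} → WeakComposition n k → (Fin k → A) → Fin n → List A
distribute (next c) B zero    = []
distribute (next c) B (suc v) = distribute c B v
distribute (take c) B zero    = B zero ∷ distribute c (B ∘ suc) zero
distribute (take c) B (suc v) = distribute c (B ∘ suc) (suc v)

distribute-cong : ∀ {n k} {A : Set} (c : WeakComposition n k) {B B′ : Fin k → A} →
                  B ≗ B′ → distribute c B ≗ distribute c B′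
distribute-cong (next c) B≗B′ zero    = refl
distribute-cong (next c) B≗B′ (suc v) = distribute-cong c B≗B′ v
distribute-cong (take c) B≗B′ zero    = cong₂ _∷_ (B≗B′ zero) (distribute-cong c (B≗B′ ∘ suc) zero)
distribute-cong (take c) B≗B′ (suc v) = distribute-cong c (B≗B′ ∘ suc) (suc v)

distribute-length : ∀ {n k} {A : Set} (c : WeakComposition n k) (B : Fin k → A) →
                    ℕΣ.sum (length ∘ distribute c B) ≡ k
distribute-length end      B = refl
distribute-length (next c) B = distribute-length c B
distribute-length (take c) B = cong suc (distribute-length c (B ∘ suc))

data Agree {n} {A : Set} : ∀ {k k′} → WeakComposition n k → (Fin k → A) → WeakComposition n k′ → (Fin k′ → A) → Set where
  agree : ∀ {k} {c : WeakComposition n k} {B B′ : Fin k → A} → B ≗ B′ → Agree c B c B′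

distribute-injective : ∀ {n k k′} {A : Set} (c : WeakComposition n k) {B : Fin k → A}
  (c′ : WeakComposition n k′) {B′ : Fin k′ → A} → distribute c B ≗ distribute c′ B′ → Agree c B c′ B′
distribute-injective end      end       eq = agree λ ()
distribute-injective (next c) (next c′) eq with distribute-injective c c′ (eq ∘ suc)
... | agree B≗B′ = agree B≗B′
distribute-injective (next c) (take c′) eq = contradiction (eq zero) λ()
distribute-injective (take c) (next c′) eq = contradiction (eq zero) λ()
distribute-injective (take c) (take c′) eq
  with distribute-injective c c′ (λ { zero → Listₚ.∷-injectiveʳ (eq zero) ; (suc v) → eq (suc v) })
... | agree B≗B′ = agree λ { zero → Listₚ.∷-injectiveˡ (eq zero) ; (suc s) → B≗B′ s }

Distribution : ∀ {n} {A : Set} → (Fin n → List A) → Set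
Distribution {n} {A} b = ∃[ k ] ∃[ c ] ∃[ B ] b ≗ distribute {n} {k} {A} c B

distribute-surjective : ∀ {n} {A : Set} (b : Fin n → List A) → Distribution b
distribute-surjective {zero}  b = 0 , end , (λ ()) , λ ()
distribute-surjective {suc n} {A} b = extend (b zero) (λ { zero → refl ; (suc v) → refl })
  where
  extend : ∀ xs {b′ : Fin (suc n) → List A} → b′ ≗ (xs Vector.∷ (b ∘ suc)) → Distribution b′
  extend []       eq = let k , c , B , rest = distribute-surjective (b ∘ suc) in
    k , next c , B , λ { zero → eq zero ; (suc v) → trans (eq (suc v)) (rest v) }
  extend (x ∷ xs) eq = let k , c , B , rest = extend xs {xs Vector.∷ (b ∘ suc)} (λ _ → refl) in
    suc k , take c , (x Vector.∷ B) ,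
    λ { zero    → trans (eq zero) (cong (x ∷_) (rest zero))
      ; (suc v) → trans (eq (suc v)) (rest (suc v)) }

module _ {A : Set} {P : Pred A 0ℓ} where

  distribute-All : ∀ {n k} (c : WeakComposition n k) {B : Fin k → A} {v} →
                   (∀ s → P (B s)) → All P (distribute c B v)
  distribute-All (next c) {v = zero}  PB = []
  distribute-All (next c) {v = suc v} PB = distribute-All c PB
  distribute-All (take c) {v = zero}  PB = PB zero ∷ distribute-All c (PB ∘ suc)
  distribute-All (take c) {v = suc v} PB = distribute-All c (PB ∘ suc)

  distribute-All⁻ : ∀ {n k} (c : WeakComposition n k) {B : Fin k → A} {v} →
                    All P (distribute c B v) → ∀ s → owner c s ≡ v → P (B s)
  distribute-All⁻ (next c)               PB       s       refl = distribute-All⁻ c PB s refl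
  distribute-All⁻ (take c)               (p ∷ PB) zero    refl = p
  distribute-All⁻ (take c) {v = zero}    (p ∷ PB) (suc s) eq   = distribute-All⁻ c PB s eq
  distribute-All⁻ (take c) {v = suc v}   PB       (suc s) eq   = distribute-All⁻ c PB s eq

  distribute-Any⁺ : ∀ {n k} (c : WeakComposition n k) {B : Fin k → A} {v} s →
                    owner c s ≡ v → P (B s) → Any P (distribute c B v)
  distribute-Any⁺ (next c)             s       refl p = distribute-Any⁺ c s refl p
  distribute-Any⁺ (take c)             zero    refl p = here p
  distribute-Any⁺ (take c) {v = zero}  (suc s) eq   p = there (distribute-Any⁺ c s eq p)
  distribute-Any⁺ (take c) {v = suc v} (suc s) eq   p = distribute-Any⁺ c s eq p

  distribute-Any⁻ : ∀ {n k} (c : WeakComposition n k) {B : Fin k → A} {v} →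
                    Any P (distribute c B v) → ∃[ s ] owner c s ≡ v × P (B s)
  distribute-Any⁻ (next c) {v = suc v} any = let s , eq , p = distribute-Any⁻ c any in s , cong suc eq , p
  distribute-Any⁻ (take c) {v = zero}  (here p)    = zero , refl , p
  distribute-Any⁻ (take c) {v = zero}  (there any) = let s , eq , p = distribute-Any⁻ c any in suc s , eq , p
  distribute-Any⁻ (take c) {v = suc v} any         = let s , eq , p = distribute-Any⁻ c any in suc s , eq , p

module _ {A : Set} {R : Rel A 0ℓ} where

  distribute-AllPairs : ∀ {n k} (c : WeakComposition n k) {B : Fin k → A} {v} →
                        (∀ {r s} → r ≢ s → R (B r) (B s)) → AllPairs R (distribute c B v)
  distribute-AllPairs (next c) {v = zero}  RB = []
  distribute-AllPairs (next c) {v = suc v} RB = distribute-AllPairs c RB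
  distribute-AllPairs (take c) {v = zero}  RB =
    distribute-All c (λ s → RB λ()) ∷ distribute-AllPairs c (λ r≢s → RB (r≢s ∘ Finₚ.suc-injective))
  distribute-AllPairs (take c) {v = suc v} RB =
    distribute-AllPairs c (λ r≢s → RB (r≢s ∘ Finₚ.suc-injective))

  distribute-AllPairs⁻ : Symmetric R → ∀ {n k} (c : WeakComposition n k) {B : Fin k → A} {v} →
    AllPairs R (distribute c B v) → ∀ r s → r ≢ s → owner c r ≡ v → owner c s ≡ v → R (B r) (B s)
  distribute-AllPairs⁻ R-sym (next c) {v = suc v} RB r s r≢s r∈v s∈v =
    distribute-AllPairs⁻ R-sym c RB r s r≢s (Finₚ.suc-injective r∈v) (Finₚ.suc-injective s∈v)
  distribute-AllPairs⁻ R-sym (take c) RB       zero    zero    r≢s _    _    = contradiction refl r≢s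
  distribute-AllPairs⁻ R-sym (take c) (R₀ ∷ _) zero    (suc s) _   refl s∈v  = distribute-All⁻ c R₀ s s∈v
  distribute-AllPairs⁻ R-sym (take c) (R₀ ∷ _) (suc r) zero    _   r∈v  refl = R-sym (distribute-All⁻ c R₀ r r∈v)
  distribute-AllPairs⁻ R-sym (take c) {v = zero}  (_ ∷ RB) (suc r) (suc s) r≢s r∈v s∈v =
    distribute-AllPairs⁻ R-sym c RB r s (r≢s ∘ cong suc) r∈v s∈v
  distribute-AllPairs⁻ R-sym (take c) {v = suc v} RB       (suc r) (suc s) r≢s r∈v s∈v =
    distribute-AllPairs⁻ R-sym c RB r s (r≢s ∘ cong suc) r∈v s∈v

∈⋃⁺ : ∀ {n} {u : Fin n} {bs} → Any (u ∈_) bs → u ∈ ⋃ bs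
∈⋃⁺ (here u∈b)  = Subsetₚ.x∈p∪q⁺ (inj₁ u∈b)
∈⋃⁺ (there any) = Subsetₚ.x∈p∪q⁺ (inj₂ (∈⋃⁺ any))

∈⋃⁻ : ∀ {n} {u : Fin n} bs → u ∈ ⋃ bs → Any (u ∈_) bs
∈⋃⁻ []       u∈⊥ = contradiction u∈⊥ Subsetₚ.∉⊥
∈⋃⁻ (b ∷ bs) u∈  = [ here , there ∘ ∈⋃⁻ bs ]′ (Subsetₚ.x∈p∪q⁻ b (⋃ bs) u∈)

module _ {n k} {o : Fin k → Fin n} (t : SlotTree o) where

  inSlot? : ∀ s u → Dec (slot t u ≡ just s)
  inSlot? s u = Maybeₚ.≡-dec Finₚ._≟_ (slot t u) (just s)

  block : Fin k → Subset n
  block s = tabulate (does ∘ inSlot? s)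

  ∈-block⁺ : ∀ {s u} → slot t u ≡ just s → u ∈ block s
  ∈-block⁺ {s} {u} u∈s = lookup⇒[]= u (block s) (trans (lookup∘tabulate (does ∘ inSlot? s) u) holds)
    where
    holds : does (inSlot? s u) ≡ true
    holds with inSlot? s u
    ... | yes _   = refl
    ... | no  u∉s = contradiction u∈s u∉s

  ∈-block⁻ : ∀ {s u} → u ∈ block s → slot t u ≡ just s
  ∈-block⁻ {s} {u} u∈b
    with inSlot? s u | trans (sym (lookup∘tabulate (does ∘ inSlot? s) u)) ([]=⇒lookup u∈b)
  ... | yes u∈s | _ = u∈s

map-just⁻ : ∀ {A B : Set} {f : A → B} {x y} → Maybe.map f x ≡ just y → ∃[ z ] x ≡ just z × f z ≡ y
map-just⁻ {x = just z} refl = z , refl , refl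

module _ {n k} (c : WeakComposition n k) (t : SlotTree (owner c)) where

  enrich : EnrichedTree n
  enrich = record
    { tree        = record
      { root        = root t
      ; parent      = Maybe.map (owner c) ∘ slot t
      ; root-orphan = Maybeₚ.map-nothing (root-free t)
      ; connected   = connected t
      }
    ; blocks      = distribute c (block t)
    ; isPartition = λ v → record
      { nonempty = distribute-All c λ s → let u , u∈s = full t s in u , ∈-block⁺ t u∈s
      ; disjoint = distribute-AllPairs c λ {r} {s} r≢s (u , u∈∩) →
          let u∈r , u∈s = Subsetₚ.x∈p∩q⁻ (block t r) (block t s) u∈∩
          in r≢s (Maybeₚ.just-injective (trans (sym (∈-block⁻ t u∈r)) (∈-block⁻ t u∈s)))
      ; covers   = λ u → mk⇔
          (λ u∈⋃ → let s , s∈v , u∈s = distribute-Any⁻ c (∈⋃⁻ (distribute c (block t) v) u∈⋃)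
                   in trans (Maybeₚ.map-just (∈-block⁻ t u∈s)) (cong just s∈v))
          (λ child → let s , u∈s , s∈v = map-just⁻ child
                     in ∈⋃⁺ (distribute-Any⁺ c s s∈v (∈-block⁺ t u∈s)))
      }
    }

  blockCount-enrich : EnrichedTree.blockCount enrich ≡ k
  blockCount-enrich = distribute-length c (block t)

block-injective : ∀ {n k} {o : Fin k → Fin n} (t t′ : SlotTree o) → block t ≗ block t′ → slot t ≗ slot t′
block-injective t t′ eq u with slot t u in tu | slot t′ u in t′u
... | nothing | nothing = refl
... | just s  | _       = sym (trans (sym t′u) (∈-block⁻ t′ (subst (u ∈_) (eq s) (∈-block⁺ t tu))))
... | nothing | just s  = trans (sym tu) (∈-block⁻ t (subst (u ∈_) (sym (eq s)) (∈-block⁺ t′ t′u)))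

module FromEnriched {n} (T : EnrichedTree n) where
  open EnrichedTree T using (parent; blocks; isPartition) renaming (root to rootT)

  slots : ℕ
  slots = proj₁ (distribute-surjective blocks)

  composition : WeakComposition n slots
  composition = proj₁ (proj₂ (distribute-surjective blocks))

  content : Fin slots → Subset n
  content = proj₁ (proj₂ (proj₂ (distribute-surjective blocks)))

  blocks-distribute : blocks ≗ distribute composition content
  blocks-distribute = proj₂ (proj₂ (proj₂ (distribute-surjective blocks)))

  partition : ∀ v → IsOrderedPartition (λ u → parent u ≡ just v) (distribute composition content v)
  partition v = subst (IsOrderedPartition _) (blocks-distribute v) (isPartition v)

  content-parent : ∀ {u s} → u ∈ content s → parent u ≡ just (owner composition s)
  content-parent {u} {s} u∈s = Equivalence.to (IsOrderedPartition.covers (partition _) u)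
    (∈⋃⁺ (distribute-Any⁺ composition s refl u∈s))

  content-covers : ∀ {u v} → parent u ≡ just v → ∃[ s ] u ∈ content s
  content-covers {u} {v} child =
    let s , _ , u∈s = distribute-Any⁻ composition
          (∈⋃⁻ (distribute composition content v) (Equivalence.from (IsOrderedPartition.covers (partition v) u) child))
    in s , u∈s

  content-disjoint : ∀ {u r s} → u ∈ content r → u ∈ content s → r ≡ s
  content-disjoint {u} {r} {s} u∈r u∈s = decidable-stable (r Finₚ.≟ s) λ r≢s →
    distribute-AllPairs⁻ (λ {p} {q} disjoint (u , u∈∩) → disjoint (u , subst (u ∈_) (Subsetₚ.∩-comm q p) u∈∩))
      composition (IsOrderedPartition.disjoint (partition (owner composition s))) r s r≢s
      (Maybeₚ.just-injective (trans (sym (content-parent u∈r)) (content-parent u∈s))) refl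
      (u , Subsetₚ.x∈p∩q⁺ (u∈r , u∈s))

  slotOf : Fin n → Maybe (Fin slots)
  slotOf u with Finₚ.any? (λ s → u Subsetₚ.∈? content s)
  ... | yes (s , _) = just s
  ... | no  _       = nothing

  slotOf⁺ : ∀ {u s} → u ∈ content s → slotOf u ≡ just s
  slotOf⁺ {u} {s} u∈s with Finₚ.any? (λ s → u Subsetₚ.∈? content s)
  ... | yes (r , u∈r) = cong just (content-disjoint u∈r u∈s)
  ... | no  u∉        = contradiction (s , u∈s) u∉

  slotOf⁻ : ∀ {u s} → slotOf u ≡ just s → u ∈ content s
  slotOf⁻ {u} eq with Finₚ.any? (λ s → u Subsetₚ.∈? content s)
  slotOf⁻ refl | yes (s , u∈s) = u∈s

  slotOf-parent : ∀ u → Maybe.map (owner composition) (slotOf u) ≡ parent u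
  slotOf-parent u with parent u in eq
  ... | just v  = let s , u∈s = content-covers eq in
    trans (Maybeₚ.map-just (slotOf⁺ u∈s)) (trans (sym (content-parent u∈s)) eq)
  ... | nothing with slotOf u in u∈s
  ...   | nothing = refl
  ...   | just s  = trans (sym (content-parent (slotOf⁻ u∈s))) eq

  slotTree : SlotTree (owner composition)
  slotTree = record
    { root      = rootT
    ; slot      = slotOf
    ; root-free = orphan (trans (slotOf-parent rootT) (EnrichedTree.root-orphan T))
    ; connected = λ v → Star.map (λ {u} edge → trans (slotOf-parent u) edge) (EnrichedTree.connected T v)
    ; full      = λ s →
        let u , u∈s = distribute-All⁻ composition (IsOrderedPartition.nonempty (partition _)) s refl
        in u , slotOf⁺ u∈s
    }
    where
    orphan : ∀ {x : Maybe (Fin slots)} → Maybe.map (owner composition) x ≡ nothing → x ≡ nothing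
    orphan {nothing} _ = refl

  block-slotTree : block slotTree ≗ content
  block-slotTree s = Subsetₚ.⊆-antisym (slotOf⁻ ∘ ∈-block⁻ slotTree) (∈-block⁺ slotTree ∘ slotOf⁺)

TreeCode : ℕ → ℕ → Set
TreeCode m k = SurjectionCode m k × WeakComposition (suc m) k

decode : ∀ m k → TreeCode m k → EnrichedTree (suc m)
decode m k (x , c) = enrich c (Bijection.to (slotTree-codes m k (owner c)) x)

decode-injective : ∀ m k k′ (x : TreeCode m k) (x′ : TreeCode m k′) →
  Setoid._≈_ (enrichedTrees (suc m)) (decode m k x) (decode m k′ x′) →
  _≡_ {A = Σ ℕ (TreeCode m)} (k , x) (k′ , x′)
decode-injective m k k′ (x , c) (x′ , c′) (root≡ , _ , blocks≗) with distribute-injective c c′ blocks≗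
... | agree block≗ = cong (λ x → k , x , c) (Bijection.injective codes
        (root≡ , block-injective (Bijection.to codes x) (Bijection.to codes x′) block≗))
  where codes = slotTree-codes m k (owner c)

toℕ-Σ-injective : ∀ {n} {P : ℕ → Set} {i j : Fin n} {x : P (toℕ i)} {y : P (toℕ j)} →
  _≡_ {A = Σ ℕ P} (toℕ i , x) (toℕ j , y) → _≡_ {A = Σ (Fin n) (P ∘ toℕ)} (i , x) (j , y)
toℕ-Σ-injective eq with Finₚ.toℕ-injective (cong proj₁ eq)
toℕ-Σ-injective refl | refl = refl

toℕ-preimage : ∀ {n k} → k < n → ∃[ i ] toℕ {n} i ≡ k
toℕ-preimage k<n = fromℕ< k<n , Finₚ.toℕ-fromℕ< k<n

enrichedTree-codes : ∀ m → Bijection (setoid (Σ (Fin (suc m)) (TreeCode m ∘ toℕ))) (enrichedTrees (suc m))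
enrichedTree-codes m = mkBijection (enrichedTrees (suc m)) (λ (k , x) → decode m (toℕ k) x)
  (λ {(k , x)} {(k′ , x′)} eq → toℕ-Σ-injective {P = TreeCode m} (decode-injective m (toℕ k) (toℕ k′) x x′ eq))
  surjective
  where
  open Setoid (enrichedTrees (suc m)) using () renaming (_≈_ to _≋_)

  surjective : StrictlySurjective _≋_ (λ (k , x) → decode m (toℕ k) x)
  surjective T = code (toℕ-preimage (s≤s (slotCount-bound slotTree))) recovered
    where
    open FromEnriched T
    codes = slotTree-codes m slots (owner composition)

    recovered : ∃[ x ] decode m slots x ≋ T
    recovered =
      let x , root≡ , slot≗ = Bijection.strictlySurjective codes slotTree
          t = Bijection.to codes x
          same-block : block t ≗ content
          same-block s = trans (tabulate-cong
            (λ u → cong (λ y → does (Maybeₚ.≡-dec Finₚ._≟_ y (just s))) (slot≗ u))) (block-slotTree s)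
      in (x , composition) , root≡ ,
         (λ u → trans (cong (Maybe.map (owner composition)) (slot≗ u)) (slotOf-parent u)) ,
         λ v → trans (distribute-cong composition same-block v) (sym (blocks-distribute v))

    code : ∀ {k} → ∃[ i ] toℕ {suc m} i ≡ k → ∃[ x ] decode m k x ≋ T →
           ∃[ x ] decode m (toℕ (proj₁ x)) (proj₂ x) ≋ T
    code (i , refl) (x , x≋T) = (i , x) , x≋T

surjectionCode-count : ∀ m k → Fin (surjections m k) ↔ SurjectionCode m k
surjectionCode-count zero    zero    = Finₚ.1↔⊤
surjectionCode-count zero    (suc k) = Finₚ.0↔⊥
surjectionCode-count (suc m) zero    = Finₚ.0↔⊥
surjectionCode-count (suc m) (suc k) = ↔-trans (Finₚ.*↔× {suc k})
  (↔-id _ ×-↔ ↔-trans Finₚ.+↔⊎ (surjectionCode-count m (suc k) ⊎-↔ surjectionCode-count m k))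

composition-count : ∀ n k → Fin (multichoose n k) ↔ WeakComposition n k
composition-count zero    zero    = mk↔ₛ′ (λ _ → end) (λ _ → zero) (λ { end → refl }) (λ { zero → refl })
composition-count (suc n) zero    = ↔-trans (composition-count n zero)
  (mk↔ₛ′ next (λ { (next c) → c }) (λ { (next c) → refl }) (λ _ → refl))
composition-count zero    (suc k) = mk↔ₛ′ (λ ()) (λ ()) (λ ()) (λ ())
composition-count (suc n) (suc k) = ↔-trans Finₚ.+↔⊎
  (↔-trans (composition-count n (suc k) ⊎-↔ composition-count (suc n) k) (mk↔ₛ′
    [ next , take ]′ (λ { (next c) → inj₁ c ; (take c) → inj₂ c })
    (λ { (next c) → refl ; (take c) → refl }) (λ { (inj₁ c) → refl ; (inj₂ c) → refl })))

treeCode-count : ∀ m k → Fin (numerator (suc m) m k) ↔ TreeCode m k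
treeCode-count m k = ↔-trans Finₚ.*↔× (surjectionCode-count m k ×-↔ composition-count (suc m) k)

Σ-count : ∀ {n} {A : Fin n → Set} (f : Fin n → ℕ) → (∀ k → Fin (f k) ↔ A k) → Fin (ℕΣ.sum f) ↔ Σ (Fin n) A
Σ-count {zero}  f count = mk↔ₛ′ (λ ()) (λ ()) (λ ()) (λ ())
Σ-count {suc n} f count = ↔-trans Finₚ.+↔⊎ (↔-trans (count zero ⊎-↔ Σ-count (f ∘ suc) (count ∘ suc)) (mk↔ₛ′
  [ zero ,_ , (λ (k , x) → suc k , x) ]′ (λ { (zero , x) → inj₁ x ; (suc k , x) → inj₂ (k , x) })
  (λ { (zero , x) → refl ; (suc k , x) → refl }) (λ { (inj₁ x) → refl ; (inj₂ (k , x)) → refl })))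

sum-↑ : ∀ m n (F : Fin (m ℕ.+ n) → ℚ) →
  ℚΣ.sum F ≡ ℚΣ.sum (λ i → F (i ↑ˡ n)) ℚ.+ ℚΣ.sum (λ i → F (m ↑ʳ i))
sum-↑ zero    n F = sym (ℚₚ.+-identityˡ (ℚΣ.sum F))
sum-↑ (suc m) n F = trans (cong (F zero ℚ.+_) (sum-↑ m n (F ∘ suc)))
  (sym (ℚₚ.+-assoc (F zero) (ℚΣ.sum (λ i → F (suc i ↑ˡ n))) (ℚΣ.sum (λ i → F (suc m ↑ʳ i)))))

sum-constant : ∀ m q → ℚΣ.sum {m} (λ _ → q) ≡ ι m ℚ.* q
sum-constant zero    q = sym (ℚₚ.*-zeroˡ q)
sum-constant (suc m) q = begin
  q ℚ.+ ℚΣ.sum {m} (λ _ → q)     ≡⟨ cong₂ ℚ._+_ (sym (ℚₚ.*-identityˡ q)) (sum-constant m q) ⟩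
  1ℚ ℚ.* q ℚ.+ ι m ℚ.* q         ≡⟨ ℚₚ.*-distribʳ-+ q 1ℚ (ι m) ⟨
  (1ℚ ℚ.+ ι m) ℚ.* q             ≡⟨ cong (ℚ._* q) (ι-+ 1 m) ⟨
  ι (suc m) ℚ.* q                ∎
  where open ≡-Reasoning

Σ-count-sum : ∀ {n} {A : Fin n → Set} (f : Fin n → ℕ) (count : ∀ k → Fin (f k) ↔ A k) (h : Fin n → ℚ) →
  ℚΣ.sum (λ i → h (proj₁ (Inverse.to (Σ-count f count) i))) ≡ ℚΣ.sum (λ k → ι (f k) ℚ.* h k)
Σ-count-sum {zero}  f count h = refl
Σ-count-sum {suc n} f count h = begin
  ℚΣ.sum F
    ≡⟨ sum-↑ (f zero) (ℕΣ.sum (f ∘ suc)) F ⟩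
  ℚΣ.sum (λ i → F (i ↑ˡ ℕΣ.sum (f ∘ suc))) ℚ.+ ℚΣ.sum (λ i → F (f zero ↑ʳ i))
    ≡⟨ cong₂ ℚ._+_ (ℚΣ.sum-cong-≗ {f zero} left) (ℚΣ.sum-cong-≗ {ℕΣ.sum (f ∘ suc)} right) ⟩
  ℚΣ.sum {f zero} (λ _ → h zero) ℚ.+ ℚΣ.sum (λ i → h (suc (proj₁ (Inverse.to (Σ-count (f ∘ suc) (count ∘ suc)) i))))
    ≡⟨ cong₂ ℚ._+_ (sum-constant (f zero) (h zero)) (Σ-count-sum (f ∘ suc) (count ∘ suc) (h ∘ suc)) ⟩
  ι (f zero) ℚ.* h zero ℚ.+ ℚΣ.sum (λ k → ι (f (suc k)) ℚ.* h (suc k))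
    ∎
  where
  open ≡-Reasoning
  F : Fin (ℕΣ.sum f) → ℚ
  F i = h (proj₁ (Inverse.to (Σ-count f count) i))

  left : ∀ i → F (i ↑ˡ ℕΣ.sum (f ∘ suc)) ≡ h zero
  left i rewrite Finₚ.splitAt-↑ˡ (f zero) i (ℕΣ.sum (f ∘ suc)) = refl

  right : ∀ i → F (f zero ↑ʳ i) ≡ h (suc (proj₁ (Inverse.to (Σ-count (f ∘ suc) (count ∘ suc)) i)))
  right i rewrite Finₚ.splitAt-↑ʳ (f zero) (ℕΣ.sum (f ∘ suc)) i = refl

generating-polynomial : ∀ m → IsGeneratingPolynomial (suc m) (polynomial (numerators m))
generating-polynomial m = ℕΣ.sum f , inverse enumeration (Bijection⇒Inverse (enrichedTree-codes m)) , weights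
  where
  open ≡-Reasoning
  f : Fin (suc m) → ℕ
  f k = numerator (suc m) m (toℕ k)

  enumeration : Fin (ℕΣ.sum f) ↔ Σ (Fin (suc m)) (TreeCode m ∘ toℕ)
  enumeration = Σ-count f (λ k → treeCode-count m (toℕ k))

  tree : Fin (ℕΣ.sum f) → EnrichedTree (suc m)
  tree i = let k , x = Inverse.to enumeration i in decode m (toℕ k) x

  weights : polynomial (ι ∘ f) ≈ sum (λ i → X ^ EnrichedTree.blockCount (tree i))
  weights j = begin
    polynomial (ι ∘ f) j
      ≡⟨ sum-coefficient (λ k → constant (ι (f k)) * X ^ toℕ k) j ⟩
    ℚΣ.sum (λ k → (constant (ι (f k)) * X ^ toℕ k) j)
      ≡⟨ ℚΣ.sum-cong-≗ {suc m} (λ k → constant-* (ι (f k)) (X ^ toℕ k) j) ⟩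
    ℚΣ.sum (λ k → ι (f k) ℚ.* (X ^ toℕ k) j)
      ≡⟨ Σ-count-sum f (λ k → treeCode-count m (toℕ k)) (λ k → (X ^ toℕ k) j) ⟨
    ℚΣ.sum (λ i → (X ^ toℕ (proj₁ (Inverse.to enumeration i))) j)
      ≡⟨ ℚΣ.sum-cong-≗ {ℕΣ.sum f} (λ i → cong (λ b → (X ^ b) j) (blockCount i)) ⟨
    ℚΣ.sum (λ i → (X ^ EnrichedTree.blockCount (tree i)) j)
      ≡⟨ sum-coefficient (λ i → X ^ EnrichedTree.blockCount (tree i)) j ⟨
    sum (λ i → X ^ EnrichedTree.blockCount (tree i)) j
      ∎
    where
    blockCount : ∀ i → EnrichedTree.blockCount (tree i) ≡ toℕ (proj₁ (Inverse.to enumeration i))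
    blockCount i = let k , x , c = Inverse.to enumeration i in
      blockCount-enrich c (Bijection.to (slotTree-codes m (toℕ k) (owner c)) x)

proposition7 : (n : ℕ) → n ≥ 1 →
    ∃! _≗_ (IsSimpleFractionExpansion n)
    × ((a : Fin n → ℚ) → IsSimpleFractionExpansion n a → IsGeneratingPolynomial n (polynomial a))
proposition7 (suc m) _ =
  (numerators m , expansion-exists m , λ {a} → expansion-unique (suc m) (numerators m) a (expansion-exists m)) ,
  λ a a-expands →
    let N , e , P≈      = generating-polynomial m
        a≗numerators = expansion-unique (suc m) a (numerators m) a-expands (expansion-exists m)
    in N , e , λ j → trans (polynomial-cong a (numerators m) a≗numerators j) (P≈ j)
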